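{- Let $n\ge 6$ and let $G$ be a tree on $n$ vertices. Suppose $G\not\cong P_n$ and the degree sequence of $G$ is not $(3,2,\ldots,2,1,1,1)$ (one vertex of degree $3$, $n-4$ of degree $2$, three of degree $1$). Then $\mathrm{irr}_t(G)\ge 6n-20$. Equality holds if and only if the degree sequence of $G$ is $(3,3,2,\ldots,2,1,1,1,1)$, i.e. exactly two vertices of degree $3$, $n-6$ vertices of degree $2$ and $4$ vertices of degree $1$.
   Context: For a graph $G=(V,E)$ and $w\in V$, $d_G(w)$ is the degree of $w$. The total irregularity is $\mathrm{irr}_t(G)=\frac12\sum_{x,y\in V}|d_G(x)-d_G(y)|$, where the sum runs over all ordered pairs of vertices. $P_n$ is the path on $n$ vertices. Degree sequences are listed in nonincreasing order. -}

module Defs where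

open import Data.Fin.Base using (Fin; toℕ)
open import Data.Integer.Base using (+_)
open import Data.List.Base using (List; _∷_; _∷ʳ_; length; filter; map; sum; allFin; cartesianProduct)
open import Data.List.Relation.Unary.Linked using (Linked)
open import Data.List.Relation.Unary.Unique.Propositional using (Unique)
open import Data.List.Sort using (sort)
open import Data.Nat.Base using (ℕ; _≤_; ∣_-_∣)
open import Data.Nat.Properties using (≤-decTotalOrder; _≟_; ∣-∣-comm; ∣n-n∣≡0; 0≢1+n)
open import Data.Product.Base using (_×_; _,_)
open import Data.Rational.Base using (ℚ; _/_)
open import Function.Bundles using (_↔_; _⇔_; Inverse)
open import Level using (0ℓ)
open import Relation.Binary.Construct.Closure.ReflexiveTransitive using (Star)
open import Relation.Binary.Core using (Rel)
open import Relation.Binary.Definitions using (Symmetric; Decidable)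
open import Relation.Binary.Properties.DecTotalOrder ≤-decTotalOrder using (≥-decTotalOrder)
open import Relation.Binary.PropositionalEquality using (_≡_; sym; trans)
open import Relation.Nullary.Negation.Core using (¬_)

-- A finite simple graph on the vertex set Fin n.
record Graph (n : ℕ) : Set₁ where
  infix 4 _~_ _~?_
  field
    _~_      : Rel (Fin n) 0ℓ
    _~?_     : Decidable _~_
    ~-sym    : Symmetric _~_
    ~-irrefl : ∀ {x} → ¬ (x ~ x)

  deg : Fin n → ℕ
  deg w = length (filter (w ~?_) (allFin n))

infix 4 _≅_

record _≅_ {m n : ℕ} (G : Graph m) (H : Graph n) : Set where
  private
    module G = Graph G
    module H = Graph H
  field
    bijection : Fin m ↔ Fin n
  open Inverse bijection public using (to; from)
  field
    adjacency : ∀ x y → (x G.~ y) ⇔ (to x H.~ to y)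

path : ∀ n → Graph n
path n = record
  { _~_      = λ i j → ∣ toℕ i - toℕ j ∣ ≡ 1
  ; _~?_     = λ i j → ∣ toℕ i - toℕ j ∣ ≟ 1
  ; ~-sym    = λ {i} {j} i~j → trans (∣-∣-comm (toℕ j) (toℕ i)) i~j
  ; ~-irrefl = λ {i} i~i → 0≢1+n (trans (sym (∣n-n∣≡0 (toℕ i))) i~i)
  }

module _ {n : ℕ} (G : Graph n) where
  open Graph G

  -- Vacuously true of the empty graph.
  Connected : Set
  Connected = ∀ x y → Star _~_ x y

  -- The cycle x, v₁, …, vₖ, x, where vs = v₁, …, vₖ; k ≥ 2 rules out
  -- walking an edge back and forth.
  record Cycle : Set where
    field
      x        : Fin n
      vs       : List (Fin n)
      long     : 2 ≤ length vs
      distinct : Unique (x ∷ vs)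
      closed   : Linked _~_ (x ∷ (vs ∷ʳ x))

  Acyclic : Set
  Acyclic = ¬ Cycle

  IsTree : Set
  IsTree = Connected × Acyclic

  degreeSequence : List ℕ
  degreeSequence = sort ≥-decTotalOrder (map deg (allFin n))

  irrₜ : ℚ
  irrₜ = + sum (map (λ (x , y) → ∣ deg x - deg y ∣) (cartesianProduct (allFin n) (allFin n))) / 2

{-# OPTIONS --safe #-}
-- Build a tree by attaching one vertex at a time to the vertices already
-- present.  Acyclicity makes each attaching edge unique, so Σ d = 2n − 2; if all
-- degrees are at most 2 and the construction starts at a leaf, only the vertex
-- added last can receive the next one, and the tree is a path.
--
-- Let L be the number of leaves, m the number of vertices of degree 2, and e the
-- sum of d − 2 over the vertices of degree at least 3; then L = e + 2.  In irrₜ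
-- the pairs of a leaf and a non-leaf contribute L (n − 2), and the pairs of a
-- vertex of degree 2 and one of degree at least 3 contribute m e.  For e ≥ 3
-- these alone exceed 6n − 20.  For e ≤ 2 the degrees above 2 are none, {3}, {4}
-- or {3, 3}; the first means a path, the second is the excluded sequence, and
-- of the other two only {3, 3} attains the bound.
module Submission where

open import Defs
open import Data.List.Base using (_∷_; _++_; replicate)
open import Data.Nat.Base using (ℕ; _*_; _∸_) renaming (_≥_ to _≥ℕ_)
open import Data.Product.Base using (_×_)
open import Data.Rational.Base using (_/_; _≥_)
open import Function.Bundles using (_⇔_)
open import Relation.Binary.PropositionalEquality using (_≡_; _≢_)
open import Relation.Nullary.Negation.Core using (¬_)

open import Data.Empty using (⊥-elim)
open import Data.Fin.Base using (Fin; zero; suc; toℕ)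
import Data.Fin.Properties as Fin
import Data.Integer.Base as ℤ
import Data.Integer.Properties as ℤ
import Algebra.Properties.AbelianGroup ℤ.+-0-abelianGroup as ℤ-Group
open import Data.List.Base using (List; []; _∷ʳ_; map; length; filter; lookup; allFin; cartesianProduct)
import Data.List.Membership.DecPropositional as DecMembership
open import Data.List.Membership.Propositional using (_∈_; _∉_)
open import Data.List.Membership.Propositional.Properties
  using (∈-allFin; ∈-filter⁺; ∈-lookup; ∈-map⁺; ∈-map⁻; ∈-++⁺ʳ)
open import Data.List.Membership.Propositional.Properties.WithK using (unique∧set⇒bag)
open import Data.List.Properties
  using (filter-accept; filter-none; filter-reject; length-++; length-map; length-replicate; length-tabulate;
         map-++; map-cong; map-∘)
open import Data.List.Relation.Binary.BagAndSetEquality using (∼bag⇒↭)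
open import Data.List.Relation.Binary.Permutation.Propositional
  using (_↭_; ↭⇒↭ₛ; ↭-refl; ↭-sym; ↭-trans; ↭-reflexive; prep)
open import Data.List.Relation.Binary.Permutation.Propositional.Properties
  using (All-resp-↭; filter-↭; map⁺; shift; ++⁺ˡ; ↭-length; ∈-resp-↭; ∷↭∷ʳ)
open import Data.List.Relation.Binary.Pointwise using (Pointwise-≡⇒≡)
open import Data.List.Relation.Unary.All as All using (All; []; _∷_)
import Data.List.Relation.Unary.All.Properties as All
open import Data.List.Relation.Unary.AllPairs as AllPairs using (AllPairs; []; _∷_)
import Data.List.Relation.Unary.AllPairs.Properties as AllPairs
open import Data.List.Relation.Unary.Any using (here; there; index)
open import Data.List.Relation.Unary.Any.Properties using (lookup-index)
open import Data.List.Relation.Unary.Linked using (Linked; [-]; _∷_)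
open import Data.List.Relation.Unary.Sorted.TotalOrder.Properties using (↗↭↗⇒≋; AllPairs⇒Sorted)
open import Data.List.Relation.Unary.Unique.Propositional using (Unique)
open import Data.List.Relation.Unary.Unique.Propositional.Properties using (++⁺; allFin⁺)
open import Data.List.Sort using (sort; sort-↭; sort-↗)
open import Data.Nat.Base using (zero; suc; _+_; _≤_; _<_; ∣_-_∣; z≤n; s≤s)
open import Data.Nat.ListAction using (sum)
open import Data.Nat.ListAction.Properties using (sum-++; sum-↭)
open import Data.Nat.Properties
open import Data.Nat.Tactic.RingSolver using (solve-∀)
open import Data.Product.Base using (_,_; ∃; ∃₂)
open import Data.Rational.Base using (fromℚᵘ; toℚᵘ) renaming (_≤_ to _≤ℚ_)
import Data.Rational.Properties as ℚ
open import Data.Rational.Unnormalised.Base as ℚᵘ using (mkℚᵘ; *≤*; *≡*)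
import Data.Rational.Unnormalised.Properties as ℚᵘ
open import Function.Base using (_∘_; id; case_of_)
open import Function.Bundles using (mk⇔; mk↔ₛ′; Equivalence)
open import Level using (0ℓ)
open import Relation.Binary.Bundles using (DecTotalOrder)
open import Relation.Binary.Construct.Closure.ReflexiveTransitive using (Star; ε; _◅_)
open import Relation.Binary.Properties.DecTotalOrder ≤-decTotalOrder using (≥-decTotalOrder)
open import Relation.Binary.PropositionalEquality
  using (refl; sym; trans; cong; cong₂; subst; subst₂; module ≡-Reasoning)
open import Relation.Nullary using (yes; no; contradiction)
open import Relation.Unary using (Pred; Decidable)

-- The double sum of degree differences, as a function of a list of numbers.

dist : ℕ → List ℕ → ℕ
dist x ys = sum (map ∣ x -_∣ ys)

-- For the list `ds` of all degrees, `gap ds ds` runs over ordered pairs, so it is twice the total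
-- irregularity. Working with it keeps the estimates in ℕ.
gap : List ℕ → List ℕ → ℕ
gap xs ys = sum (map (λ x → dist x ys) xs)

sum-cartesianProduct : ∀ {A B : Set} (f : A × B → ℕ) xs ys →
  sum (map f (cartesianProduct xs ys)) ≡ sum (map (λ x → sum (map (λ y → f (x , y)) ys)) xs)
sum-cartesianProduct f []       ys = refl
sum-cartesianProduct f (x ∷ xs) ys = begin
  sum (map f (map (x ,_) ys ++ cartesianProduct xs ys))             ≡⟨ cong sum (map-++ f (map (x ,_) ys) _) ⟩
  sum (map f (map (x ,_) ys) ++ map f (cartesianProduct xs ys))     ≡⟨ sum-++ (map f (map (x ,_) ys)) _ ⟩
  sum (map f (map (x ,_) ys)) + sum (map f (cartesianProduct xs ys))
    ≡⟨ cong₂ _+_ (cong sum (sym (map-∘ ys))) (sum-cartesianProduct f xs ys) ⟩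
  sum (map (λ y → f (x , y)) ys) + sum (map (λ x → sum (map (λ y → f (x , y)) ys)) xs) ∎
  where open ≡-Reasoning

sum-gap : ∀ {A : Set} (d : A → ℕ) xs →
  sum (map (λ (x , y) → ∣ d x - d y ∣) (cartesianProduct xs xs)) ≡ gap (map d xs) (map d xs)
sum-gap d xs = begin
  sum (map (λ (x , y) → ∣ d x - d y ∣) (cartesianProduct xs xs)) ≡⟨ sum-cartesianProduct _ xs xs ⟩
  sum (map (λ x → sum (map (λ y → ∣ d x - d y ∣) xs)) xs)        ≡⟨ cong sum (map-cong (λ x → cong sum (map-∘ xs)) xs) ⟩
  sum (map (λ x → dist (d x) (map d xs)) xs)                     ≡⟨ cong sum (map-∘ xs) ⟩
  gap (map d xs) (map d xs)                                      ∎
  where open ≡-Reasoning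

gap-resp-↭ : ∀ {xs ys} → xs ↭ ys → gap xs xs ≡ gap ys ys
gap-resp-↭ {xs} {ys} xs↭ys = begin
  gap xs xs ≡⟨ cong sum (map-cong (λ x → sum-↭ (map⁺ ∣ x -_∣ xs↭ys)) xs) ⟩
  gap xs ys ≡⟨ sum-↭ (map⁺ (λ x → dist x ys) xs↭ys) ⟩
  gap ys ys ∎
  where open ≡-Reasoning

gap-++ˡ : ∀ xs ys zs → gap (xs ++ ys) zs ≡ gap xs zs + gap ys zs
gap-++ˡ xs ys zs = trans (cong sum (map-++ (λ x → dist x zs) xs ys)) (sum-++ (map (λ x → dist x zs) xs) _)

gap-[]ʳ : ∀ xs → gap xs [] ≡ 0
gap-[]ʳ []       = refl
gap-[]ʳ (_ ∷ xs) = gap-[]ʳ xs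

gap-∷ʳ : ∀ xs y ys → gap xs (y ∷ ys) ≡ dist y xs + gap xs ys
gap-∷ʳ []       y ys = refl
gap-∷ʳ (x ∷ xs) y ys = begin
  ∣ x - y ∣ + dist x ys + gap xs (y ∷ ys)         ≡⟨ cong₂ (λ a b → a + dist x ys + b) (∣-∣-comm x y) (gap-∷ʳ xs y ys) ⟩
  ∣ y - x ∣ + dist x ys + (dist y xs + gap xs ys) ≡⟨ interchange ∣ y - x ∣ (dist x ys) (dist y xs) (gap xs ys) ⟩
  ∣ y - x ∣ + dist y xs + (dist x ys + gap xs ys) ∎
  where
  open ≡-Reasoning
  interchange : ∀ a b c d → a + b + (c + d) ≡ a + c + (b + d)
  interchange = solve-∀

gap-comm : ∀ xs ys → gap xs ys ≡ gap ys xs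
gap-comm xs []       = gap-[]ʳ xs
gap-comm xs (y ∷ ys) = trans (gap-∷ʳ xs y ys) (cong (dist y xs +_) (gap-comm xs ys))

-- Of the four blocks of pairs, the two mixed ones agree by `gap-comm`; hence the factor 2.
gap-++-self : ∀ xs ys → gap (xs ++ ys) (xs ++ ys) ≡ gap xs xs + gap ys ys + 2 * gap ys xs
gap-++-self xs ys = begin
  gap (xs ++ ys) (xs ++ ys)                         ≡⟨ gap-++ˡ xs ys (xs ++ ys) ⟩
  gap xs (xs ++ ys) + gap ys (xs ++ ys)             ≡⟨ cong₂ _+_ (gap-comm xs (xs ++ ys)) (gap-comm ys (xs ++ ys)) ⟩
  gap (xs ++ ys) xs + gap (xs ++ ys) ys             ≡⟨ cong₂ _+_ (gap-++ˡ xs ys xs) (gap-++ˡ xs ys ys) ⟩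
  gap xs xs + gap ys xs + (gap xs ys + gap ys ys)   ≡⟨ cong (λ a → gap xs xs + gap ys xs + (a + gap ys ys)) (gap-comm xs ys) ⟩
  gap xs xs + gap ys xs + (gap ys xs + gap ys ys)   ≡⟨ rearrange (gap xs xs) (gap ys xs) (gap ys ys) ⟩
  gap xs xs + gap ys ys + 2 * gap ys xs             ∎
  where
  open ≡-Reasoning
  rearrange : ∀ a b c → a + b + (b + c) ≡ a + c + 2 * b
  rearrange = solve-∀

sum-replicate : ∀ k a → sum (replicate k a) ≡ k * a
sum-replicate zero    a = refl
sum-replicate (suc k) a = cong (a +_) (sum-replicate k a)

dist-replicate : ∀ x k a → dist x (replicate k a) ≡ k * ∣ x - a ∣
dist-replicate x zero    a = refl
dist-replicate x (suc k) a = cong (∣ x - a ∣ +_) (dist-replicate x k a)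

gap-replicateˡ : ∀ k a ys → gap (replicate k a) ys ≡ k * dist a ys
gap-replicateˡ zero    a ys = refl
gap-replicateˡ (suc k) a ys = cong (dist a ys +_) (gap-replicateˡ k a ys)

gap-replicate : ∀ k a l b → gap (replicate k a) (replicate l b) ≡ k * (l * ∣ a - b ∣)
gap-replicate k a l b = trans (gap-replicateˡ k a (replicate l b)) (cong (k *_) (dist-replicate a l b))

gap-replicate-self : ∀ k a → gap (replicate k a) (replicate k a) ≡ 0
gap-replicate-self k a = begin
  gap (replicate k a) (replicate k a) ≡⟨ gap-replicate k a k a ⟩
  k * (k * ∣ a - a ∣)                 ≡⟨ cong (λ d → k * (k * d)) (∣n-n∣≡0 a) ⟩
  k * (k * 0)                         ≡⟨ cong (k *_) (*-zeroʳ k) ⟩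
  k * 0                               ≡⟨ *-zeroʳ k ⟩
  0                                   ∎
  where open ≡-Reasoning

-- Degree multisets split into large degrees, twos and ones.

sum-map-+ : ∀ k xs → sum (map (k +_) xs) ≡ length xs * k + sum xs
sum-map-+ k []       = refl
sum-map-+ k (x ∷ xs) = trans (cong (k + x +_) (sum-map-+ k xs)) (interchange k x (length xs * k) (sum xs))
  where
  interchange : ∀ a b c d → a + b + (c + d) ≡ a + c + (b + d)
  interchange = solve-∀

-- An entry c of cs stands for a vertex of degree 3 + c.
profile : List ℕ → ℕ → ℕ → List ℕ
profile cs m l = map (3 +_) cs ++ replicate m 2 ++ replicate l 1

excess : List ℕ → ℕ
excess cs = sum (map suc cs)

↭-profile : ∀ {ds} → All (1 ≤_) ds → ∃ λ cs → ∃₂ λ m l → ds ↭ profile cs m l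
↭-profile []           = [] , 0 , 0 , ↭-refl
↭-profile (_∷_ {x = suc zero}    _ ps) with cs , m , l , σ ← ↭-profile ps =
  cs , m , suc l , ↭-trans (prep 1 σ)
    (↭-trans (↭-sym (shift 1 (map (3 +_) cs) _)) (++⁺ˡ (map (3 +_) cs) (↭-sym (shift 1 (replicate m 2) _))))
↭-profile (_∷_ {x = suc (suc zero)} _ ps) with cs , m , l , σ ← ↭-profile ps =
  cs , suc m , l , ↭-trans (prep 2 σ) (↭-sym (shift 2 (map (3 +_) cs) _))
↭-profile (_∷_ {x = suc (suc (suc c))} _ ps) with cs , m , l , σ ← ↭-profile ps =
  c ∷ cs , m , l , prep (3 + c) σ

length-profile : ∀ cs m l → length (profile cs m l) ≡ length cs + (m + l)
length-profile cs m l = begin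
  length (profile cs m l)
    ≡⟨ length-++ (map (3 +_) cs) ⟩
  length (map (3 +_) cs) + length (replicate m 2 ++ replicate l 1)
    ≡⟨ cong₂ _+_ (length-map _ cs) (length-++ (replicate m 2)) ⟩
  length cs + (length (replicate m 2) + length (replicate l 1))
    ≡⟨ cong₂ (λ a b → length cs + (a + b)) (length-replicate m) (length-replicate l) ⟩
  length cs + (m + l) ∎
  where open ≡-Reasoning

excess-sum : ∀ cs → excess cs ≡ length cs + sum cs
excess-sum cs = trans (sum-map-+ 1 cs) (cong (_+ sum cs) (*-identityʳ (length cs)))

sum-profile : ∀ cs m l → sum (profile cs m l) ≡ 2 * length cs + excess cs + (2 * m + l)
sum-profile cs m l = begin
  sum (profile cs m l)
    ≡⟨ sum-++ (map (3 +_) cs) _ ⟩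
  sum (map (3 +_) cs) + sum (replicate m 2 ++ replicate l 1)
    ≡⟨ cong₂ _+_ (sum-map-+ 3 cs) (sum-++ (replicate m 2) _) ⟩
  length cs * 3 + sum cs + (sum (replicate m 2) + sum (replicate l 1))
    ≡⟨ cong₂ (λ a b → length cs * 3 + sum cs + (a + b)) (sum-replicate m 2) (sum-replicate l 1) ⟩
  length cs * 3 + sum cs + (m * 2 + l * 1)
    ≡⟨ rearrange (length cs) (sum cs) m l ⟩
  2 * length cs + (length cs + sum cs) + (2 * m + l)
    ≡⟨ cong (λ e → 2 * length cs + e + (2 * m + l)) (sym (excess-sum cs)) ⟩
  2 * length cs + excess cs + (2 * m + l) ∎
  where
  open ≡-Reasoning
  rearrange : ∀ k s m l → k * 3 + s + (m * 2 + l * 1) ≡ 2 * k + (k + s) + (2 * m + l)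
  rearrange = solve-∀

-- Equal degrees contribute nothing, so beyond the large degrees among themselves only mixed pairs
-- remain. A degree `3 + c` differs by `1 + c` from 2 and by `2 + c` from 1; summed over `cs` this
-- gives `excess cs` and `length cs + excess cs`.
gap-profile : ∀ cs m l → let bs = map (3 +_) cs in
  gap (profile cs m l) (profile cs m l) ≡
  gap bs bs + 2 * (m * excess cs + l * (length cs + excess cs) + m * l)
gap-profile cs m l = begin
  gap (profile cs m l) (profile cs m l)
    ≡⟨ gap-++-self bs (twos ++ ones) ⟩
  gap bs bs + gap (twos ++ ones) (twos ++ ones) + 2 * gap (twos ++ ones) bs
    ≡⟨ cong₂ (λ a b → gap bs bs + a + 2 * b) (gap-++-self twos ones) (gap-++ˡ twos ones bs) ⟩
  gap bs bs + (gap twos twos + gap ones ones + 2 * gap ones twos) + 2 * (gap twos bs + gap ones bs)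
    ≡⟨ cong₂ (λ a b → gap bs bs + (a + b + 2 * gap ones twos) + 2 * (gap twos bs + gap ones bs))
         (gap-replicate-self m 2) (gap-replicate-self l 1) ⟩
  gap bs bs + 2 * gap ones twos + 2 * (gap twos bs + gap ones bs)
    ≡⟨ cong₂ (λ a b → gap bs bs + 2 * a + 2 * b) (gap-replicate l 1 m 2)
         (cong₂ _+_ (trans (gap-replicateˡ m 2 bs) (cong (m *_) dist-2))
                    (trans (gap-replicateˡ l 1 bs) (cong (l *_) dist-1))) ⟩
  gap bs bs + 2 * (l * (m * 1)) + 2 * (m * excess cs + l * (length cs + excess cs))
    ≡⟨ rearrange (gap bs bs) m l (excess cs) (length cs) ⟩
  gap bs bs + 2 * (m * excess cs + l * (length cs + excess cs) + m * l) ∎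
  where
  open ≡-Reasoning
  bs twos ones : List ℕ
  bs   = map (3 +_) cs
  twos = replicate m 2
  ones = replicate l 1
  dist-2 : dist 2 bs ≡ excess cs
  dist-2 = cong sum (sym (map-∘ cs))
  dist-1 : dist 1 bs ≡ length cs + excess cs
  dist-1 = begin
    dist 1 bs                       ≡⟨ cong sum (sym (map-∘ cs)) ⟩
    sum (map (2 +_) cs)             ≡⟨ sum-map-+ 2 cs ⟩
    length cs * 2 + sum cs          ≡⟨ double (length cs) (sum cs) ⟩
    length cs + (length cs + sum cs) ≡⟨ cong (length cs +_) (sym (excess-sum cs)) ⟩
    length cs + excess cs           ∎
    where
    double : ∀ a b → a * 2 + b ≡ a + (a + b)
    double = solve-∀
  rearrange : ∀ g m l e c → g + 2 * (l * (m * 1)) + 2 * (m * e + l * (c + e)) ≡ g + 2 * (m * e + l * (c + e) + m * l)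
  rearrange = solve-∀

-- The hypothesis says that d - 2 sums to -2 over all degrees d. Each leaf contributes -1, each two
-- contributes 0, and the large degrees contribute `excess cs` together.
leaf-count : ∀ cs m l → 2 + sum (profile cs m l) ≡ 2 * length (profile cs m l) → l ≡ 2 + excess cs
leaf-count cs m l eq = sym (+-cancelʳ-≡ (2 * length cs + 2 * m + l) _ _ (begin
  2 + excess cs + (2 * length cs + 2 * m + l)   ≡⟨ rearrangeˡ (length cs) (excess cs) m l ⟩
  2 + (2 * length cs + excess cs + (2 * m + l)) ≡⟨ cong (2 +_) (sum-profile cs m l) ⟨
  2 + sum (profile cs m l)                      ≡⟨ eq ⟩
  2 * length (profile cs m l)                   ≡⟨ cong (2 *_) (length-profile cs m l) ⟩
  2 * (length cs + (m + l))                     ≡⟨ rearrangeʳ (length cs) m l ⟩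
  l + (2 * length cs + 2 * m + l)               ∎))
  where
  open ≡-Reasoning
  rearrangeˡ : ∀ c e m l → 2 + e + (2 * c + 2 * m + l) ≡ 2 + (2 * c + e + (2 * m + l))
  rearrangeˡ = solve-∀
  rearrangeʳ : ∀ c m l → 2 * (c + (m + l)) ≡ l + (2 * c + 2 * m + l)
  rearrangeʳ = solve-∀

length≤excess : ∀ cs → length cs ≤ excess cs
length≤excess cs = subst (length cs ≤_) (sym (excess-sum cs)) (m≤m+n _ _)

-- The numerical bound, by the shape of the degree multiset.

private
  -- Here `c` counts the large degrees, the excess is `3 + f` and there are `5 + f` leaves; 12 and
  -- 40 are the doubles of 6 and 20. For `f` = 0 the coefficient of `c` on the right is 10, below
  -- 12, and `c ≤ 3` makes up the deficit. For larger `f` the difference of the two sides is a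
  -- polynomial with nonnegative coefficients.
  many-leaves-bound : ∀ c m f → c ≤ 3 + f →
    12 * (c + (m + (5 + f))) < 2 * (m * (3 + f) + (5 + f) * (c + (3 + f)) + m * (5 + f)) + 40
  many-leaves-bound c m zero c≤3 = begin-strict
    12 * (c + (m + 5))                                     ≡⟨ lhs c m ⟩
    2 * c + (10 * c + 12 * m + 60)                         ≤⟨ +-monoˡ-≤ _ (*-monoʳ-≤ 2 c≤3) ⟩
    2 * (3 + 0) + (10 * c + 12 * m + 60)                   <⟨ m<m+n _ {4 + 4 * m} (s≤s z≤n) ⟩
    2 * (3 + 0) + (10 * c + 12 * m + 60) + (4 + 4 * m)     ≡⟨ rhs c m ⟩
    2 * (m * (3 + 0) + (5 + 0) * (c + (3 + 0)) + m * (5 + 0)) + 40 ∎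
    where
    open ≤-Reasoning
    lhs : ∀ c m → 12 * (c + (m + 5)) ≡ 2 * c + (10 * c + 12 * m + 60)
    lhs = solve-∀
    rhs : ∀ c m → 2 * (3 + 0) + (10 * c + 12 * m + 60) + (4 + 4 * m) ≡ 2 * (m * (3 + 0) + (5 + 0) * (c + (3 + 0)) + m * (5 + 0)) + 40
    rhs = solve-∀
  many-leaves-bound c m (suc f) _ = begin-strict
    12 * (c + (m + (5 + suc f)))  <⟨ m<m+n _ {surplus} (s≤s z≤n) ⟩
    12 * (c + (m + (5 + suc f))) + surplus ≡⟨ rearrange c m f ⟩
    2 * (m * (3 + suc f) + (5 + suc f) * (c + (3 + suc f)) + m * (5 + suc f)) + 40 ∎
    where
    open ≤-Reasoning
    surplus : ℕ
    -- The right side minus the left, expanded; its constant term makes the inequality strict.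
    surplus = 16 + 8 * m + 8 * f + 4 * m * f + 2 * c * f + 2 * f * f
    rearrange : ∀ c m f → 12 * (c + (m + (5 + suc f))) + (16 + 8 * m + 8 * f + 4 * m * f + 2 * c * f + 2 * f * f) ≡
      2 * (m * (3 + suc f) + (5 + suc f) * (c + (3 + suc f)) + m * (5 + suc f)) + 40
    rearrange = solve-∀

module _ {ds : List ℕ} (cs : List ℕ) (m l : ℕ) (σ : ds ↭ profile cs m l) where

  length-via-profile : length ds ≡ length cs + (m + l)
  length-via-profile = trans (↭-length σ) (length-profile cs m l)

  gap-via-profile : let bs = map (3 +_) cs in
    gap ds ds ≡ gap bs bs + 2 * (m * excess cs + l * (length cs + excess cs) + m * l)
  gap-via-profile = trans (gap-resp-↭ σ) (gap-profile cs m l)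

two-threes-gap : ∀ {ds} m → ds ↭ profile (0 ∷ 0 ∷ []) m 4 → 12 * length ds ≡ gap ds ds + 40
two-threes-gap {ds} m σ = begin
  12 * length ds                                ≡⟨ cong (12 *_) (length-via-profile (0 ∷ 0 ∷ []) m 4 σ) ⟩
  12 * (2 + (m + 4))                            ≡⟨ rearrange m ⟩
  2 * (m * 2 + 4 * (2 + 2) + m * 4) + 40        ≡⟨ cong (_+ 40) (gap-via-profile (0 ∷ 0 ∷ []) m 4 σ) ⟨
  gap ds ds + 40                                ∎
  where
  open ≡-Reasoning
  rearrange : ∀ m → 12 * (2 + (m + 4)) ≡ 2 * (m * 2 + 4 * (2 + 2) + m * 4) + 40
  rearrange = solve-∀

one-four-gap : ∀ {ds} m → ds ↭ profile (1 ∷ []) m 4 → 12 * length ds < gap ds ds + 40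
one-four-gap {ds} m σ = begin-strict
  12 * length ds                                ≡⟨ cong (12 *_) (length-via-profile (1 ∷ []) m 4 σ) ⟩
  12 * (1 + (m + 4))                            <⟨ m<m+n _ {4} (s≤s z≤n) ⟩
  12 * (1 + (m + 4)) + 4                        ≡⟨ rearrange m ⟩
  2 * (m * 2 + 4 * (1 + 2) + m * 4) + 40        ≡⟨ cong (_+ 40) (gap-via-profile (1 ∷ []) m 4 σ) ⟨
  gap ds ds + 40                                ∎
  where
  open ≤-Reasoning
  rearrange : ∀ m → 12 * (1 + (m + 4)) + 4 ≡ 2 * (m * 2 + 4 * (1 + 2) + m * 4) + 40
  rearrange = solve-∀

-- The term `gap bs bs`, from pairs of large degrees, is simply dropped: the mixed pairs already
-- exceed the bound.
many-leaves-gap : ∀ {ds} cs {m} f → excess cs ≡ 3 + f → ds ↭ profile cs m (2 + excess cs) →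
  12 * length ds < gap ds ds + 40
many-leaves-gap {ds} cs {m} f e≡ σ = begin-strict
  12 * length ds                                               ≡⟨ cong (12 *_) (length-via-profile cs m (2 + excess cs) σ) ⟩
  12 * (length cs + (m + (2 + excess cs)))                     <⟨ bound ⟩
  2 * (m * excess cs + (2 + excess cs) * (length cs + excess cs) + m * (2 + excess cs)) + 40
                                                               ≤⟨ +-monoˡ-≤ 40 (m≤n+m _ (gap bs bs)) ⟩
  gap bs bs + 2 * (m * excess cs + (2 + excess cs) * (length cs + excess cs) + m * (2 + excess cs)) + 40
                                                               ≡⟨ cong (_+ 40) (gap-via-profile cs m (2 + excess cs) σ) ⟨
  gap ds ds + 40                                               ∎
  where
  open ≤-Reasoning
  bs : List ℕ
  bs = map (3 +_) cs
  bound : 12 * (length cs + (m + (2 + excess cs))) <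
    2 * (m * excess cs + (2 + excess cs) * (length cs + excess cs) + m * (2 + excess cs)) + 40
  bound = subst (λ e → 12 * (length cs + (m + (2 + e))) < 2 * (m * e + (2 + e) * (length cs + e) + m * (2 + e)) + 40)
    (sym e≡) (many-leaves-bound (length cs) m f (subst (length cs ≤_) e≡ (length≤excess cs)))

-- The first two shapes are those excluded in the theorem and the third attains equality. Every
-- other shape is remembered only through its strict inequality.
data GapCase (ds : List ℕ) (m : ℕ) : Set where
  path-like  : ds ↭ profile [] m 2 → GapCase ds m
  one-three  : ds ↭ profile (0 ∷ []) m 3 → GapCase ds m
  two-threes : ds ↭ profile (0 ∷ 0 ∷ []) m 4 → GapCase ds m
  large      : 12 * length ds < gap ds ds + 40 → GapCase ds m

-- The split isolates the lists `cs` of excess at most 2. In the remaining clauses the second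
-- explicit argument of `many-leaves-gap` is the excess minus 3.
gap-cases : ∀ {ds} cs {m} → ds ↭ profile cs m (2 + excess cs) → GapCase ds m
gap-cases []                              σ = path-like σ
gap-cases (0 ∷ [])                        σ = one-three σ
gap-cases (1 ∷ [])                        σ = large (one-four-gap _ σ)
gap-cases (suc (suc c) ∷ [])              σ = large (many-leaves-gap (suc (suc c) ∷ []) (c + 0) refl σ)
gap-cases (0 ∷ 0 ∷ [])                    σ = two-threes σ
gap-cases (0 ∷ 0 ∷ c ∷ cs)                σ = large (many-leaves-gap (0 ∷ 0 ∷ c ∷ cs) (c + excess cs) refl σ)
gap-cases (0 ∷ suc c ∷ cs)                σ = large (many-leaves-gap (0 ∷ suc c ∷ cs) (c + excess cs) refl σ)
gap-cases (suc c ∷ d ∷ cs)                σ = large (many-leaves-gap (suc c ∷ d ∷ cs) (c + (d + excess cs)) (cong (2 +_) (+-suc c _)) σ)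

tree-gap-cases : ∀ {ds} → All (1 ≤_) ds → 2 + sum ds ≡ 2 * length ds → ∃ (GapCase ds)
tree-gap-cases {ds} 1≤ds eq with cs , m , l , σ ← ↭-profile 1≤ds =
  m , gap-cases cs (subst (λ l → ds ↭ profile cs m l) (leaf-count cs m l eq′) σ)
  where
  eq′ : 2 + sum (profile cs m l) ≡ 2 * length (profile cs m l)
  eq′ = subst₂ (λ s k → 2 + s ≡ 2 * k) (sum-↭ σ) (↭-length σ) eq

-- Sorted degree sequences.

private
  ≥-totalOrder = DecTotalOrder.totalOrder ≥-decTotalOrder

sort-unique : ∀ {xs ys} → AllPairs _≥ℕ_ ys → xs ↭ ys → sort ≥-decTotalOrder xs ≡ ys
sort-unique {xs} ys↘ xs↭ys = Pointwise-≡⇒≡ (↗↭↗⇒≋ ≥-totalOrder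
  (sort-↗ ≥-decTotalOrder xs) (AllPairs⇒Sorted ≥-totalOrder ys↘)
  (↭⇒↭ₛ (↭-trans (sort-↭ ≥-decTotalOrder xs) xs↭ys)))

replicate-≥ : ∀ k a → AllPairs _≥ℕ_ (replicate k a)
replicate-≥ zero    a = []
replicate-≥ (suc k) a = All.replicate⁺ k ≤-refl ∷ replicate-≥ k a

profile-≥ : ∀ {cs} m l → AllPairs _≥ℕ_ cs → AllPairs _≥ℕ_ (profile cs m l)
profile-≥ {cs} m l cs↘ =
  AllPairs.++⁺ (AllPairs.map⁺ (AllPairs.map (+-monoʳ-≤ 3) cs↘))
    (AllPairs.++⁺ (replicate-≥ m 2) (replicate-≥ l 1)
      (All.replicate⁺ m (All.replicate⁺ l (s≤s z≤n))))
    (All.map⁺ (All.universal (λ c → All.++⁺ (All.replicate⁺ m (s≤s (s≤s z≤n))) (All.replicate⁺ l (s≤s z≤n))) cs))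

-- Counting in lists without repetitions.

module _ {A : Set} where

  ∉⇒All≢ : ∀ {x : A} {xs} → x ∉ xs → All (x ≢_) xs
  ∉⇒All≢ = All.¬Any⇒All¬ _

  unique-lookup-injective : ∀ {xs : List A} → Unique xs → ∀ {i j} → lookup xs i ≡ lookup xs j → i ≡ j
  unique-lookup-injective (_ ∷ _)  {zero}  {zero}  _  = refl
  unique-lookup-injective (x∉ ∷ _) {zero}  {suc j} eq = contradiction eq (All.lookup x∉ (∈-lookup j))
  unique-lookup-injective (x∉ ∷ _) {suc i} {zero}  eq = contradiction (sym eq) (All.lookup x∉ (∈-lookup i))
  unique-lookup-injective (_ ∷ xs!) {suc i} {suc j} eq = cong suc (unique-lookup-injective xs! eq)

  -- Pigeonhole: sending each position in `xs` to a position of the same element in `ys` is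
  -- injective, as `xs` has no repetitions.
  unique-⊆⇒length≤ : ∀ {xs ys : List A} → Unique xs → (∀ {x} → x ∈ xs → x ∈ ys) → length xs ≤ length ys
  unique-⊆⇒length≤ {xs} {ys} xs! xs⊆ys = Fin.injective⇒≤ {f = position} position-injective
    where
    position : Fin (length xs) → Fin (length ys)
    position i = index (xs⊆ys (∈-lookup i))
    position-injective : ∀ {i j} → position i ≡ position j → i ≡ j
    position-injective {i} {j} eq = unique-lookup-injective xs! (begin
      lookup xs i            ≡⟨ lookup-index (xs⊆ys (∈-lookup i)) ⟩
      lookup ys (position i) ≡⟨ cong (lookup ys) eq ⟩
      lookup ys (position j) ≡⟨ lookup-index (xs⊆ys (∈-lookup j)) ⟨
      lookup xs j            ∎)
      where open ≡-Reasoning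

  filter-unique-length : ∀ {P : Pred A 0ℓ} (P? : Decidable P) {p xs} → Unique xs → p ∈ xs → P p →
    (∀ {q} → q ∈ xs → P q → p ≡ q) → length (filter P? xs) ≡ 1
  filter-unique-length P? {xs = x ∷ xs} (x∉ ∷ _) (here refl) Pp only =
    trans (cong length (filter-accept P? Pp))
      (cong (suc ∘ length) (filter-none P? (All.tabulate λ q∈ Pq → All.lookup x∉ q∈ (only (there q∈) Pq))))
  filter-unique-length P? {xs = x ∷ xs} (x∉ ∷ xs!) (there p∈) Pp only =
    trans (cong length (filter-reject P? λ Px → All.lookup x∉ p∈ (sym (only (here refl) Px))))
      (filter-unique-length P? xs! p∈ Pp (only ∘ there))

  -- Double counting: the related pairs with second component `v` are counted separately, by their
  -- first component.
  sum-filter-∷ : ∀ {R : A → A → Set} (R? : ∀ x → Decidable (R x)) v ys xs →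
    sum (map (λ x → length (filter (R? x) (v ∷ ys))) xs) ≡
    length (filter (λ x → R? x v) xs) + sum (map (λ x → length (filter (R? x) ys)) xs)
  sum-filter-∷ R? v ys [] = refl
  sum-filter-∷ R? v ys (x ∷ xs) with R? x v | shift-term
    where
    k c s : ℕ
    k = length (filter (R? x) ys)
    c = length (filter (λ x → R? x v) xs)
    s = sum (map (λ x → length (filter (R? x) ys)) xs)
    swap : ∀ a b c → a + (b + c) ≡ b + (a + c)
    swap = solve-∀
    shift-term : k + sum (map (λ x → length (filter (R? x) (v ∷ ys))) xs) ≡ c + (k + s)
    shift-term = trans (cong (_+_ k) (sum-filter-∷ R? v ys xs)) (swap k c s)
  -- If `R x v` holds, both sides gain one; otherwise neither does.
  ... | yes _ | eq = cong suc eq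
  ... | no _  | eq = eq

  unique-∷ʳ : ∀ {xs : List A} {v} → Unique xs → v ∉ xs → Unique (xs ∷ʳ v)
  unique-∷ʳ xs! v∉ = ++⁺ xs! ([] ∷ []) λ { (v∈ , here refl) → v∉ v∈ }

-- Exhausting the vertex set by successive enlargement.

another : ∀ {n} → 2 ≤ n → (w : Fin n) → ∃ λ u → w ≢ u
another (s≤s (s≤s _)) zero    = suc zero , λ ()
another (s≤s (s≤s _)) (suc _) = zero , λ ()

module _ {n : ℕ} {vs : List (Fin n)} (vs! : Unique vs) where

  unique-length≤n : length vs ≤ n
  unique-length≤n = subst (length vs ≤_) (length-tabulate id) (unique-⊆⇒length≤ vs! λ {x} _ → ∈-allFin x)

  enumeration-↭ : (∀ x → x ∈ vs) → vs ↭ allFin n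
  enumeration-↭ all∈ = ∼bag⇒↭ (unique∧set⇒bag vs! (allFin⁺ n) (mk⇔ (λ _ → ∈-allFin _) (λ _ → all∈ _)))

module _ {n : ℕ} (P : Pred (List (Fin n)) 0ℓ)
  (P⇒unique : ∀ {vs} → P vs → Unique vs)
  (enlarge : ∀ {vs x} → P vs → x ∉ vs → ∃ λ v → P (v ∷ vs)) where

  private
    open DecMembership (Fin._≟_ {n}) using (_∈?_)

    -- `k` is fuel. The invariant `n ≤ k + length vs` ensures that an enlargement at fuel 0 would
    -- give more than `n` distinct vertices.
    fill : ∀ k {vs} → P vs → n ≤ k + length vs → ∃ λ ws → P ws × ∀ x → x ∈ ws
    fill k {vs} Pvs n≤ with Fin.all? (_∈? vs)
    ... | yes all∈ = vs , Pvs , all∈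
    ... | no ¬all with x , x∉ ← Fin.¬∀⟶∃¬ n _ (_∈? vs) ¬all | enlarge Pvs x∉
    fill zero    Pvs n≤ | no _ | v , Pvvs = contradiction (≤-trans (unique-length≤n (P⇒unique Pvvs)) n≤) (<-irrefl refl)
    fill (suc k) Pvs n≤ | no _ | v , Pvvs = fill k Pvvs (≤-trans n≤ (≤-reflexive (sym (+-suc k _))))

  -- A missing vertex only triggers an enlargement; the vertex added may be another one, as when a
  -- tree grows towards a distant vertex.
  exhaust : ∀ {vs} → P vs → ∃ λ ws → P ws × ∀ x → x ∈ ws
  exhaust Pvs = fill n Pvs (m≤m+n n _)

-- Growing a tree vertex by vertex, and its degree sum.

module _ {n : ℕ} (G : Graph n) where
  open Graph G
  open DecMembership (Fin._≟_ {n}) using (_∈?_)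

  -- The newest vertex stands first. Only the existence of an attaching edge is recorded; its
  -- uniqueness comes later, from acyclicity.
  data Grown : List (Fin n) → Set where
    root   : ∀ {r} → Grown (r ∷ [])
    attach : ∀ {v p vs} → v ∉ vs → p ∈ vs → v ~ p → Grown vs → Grown (v ∷ vs)

  grown-unique : ∀ {vs} → Grown vs → Unique vs
  grown-unique root               = [] ∷ []
  grown-unique (attach v∉ _ _ gr) = ∉⇒All≢ v∉ ∷ grown-unique gr

  -- Walks that carry their list of vertices, both ends included, since `Cycle` is phrased through
  -- such a list.
  data Route : Fin n → Fin n → List (Fin n) → Set where
    stop : ∀ {p} → Route p p (p ∷ [])
    step : ∀ {p r q vs} → p ~ r → Route r q vs → Route p q (p ∷ vs)

  route-∷ʳ : ∀ {p q v vs} → Route p q vs → q ~ v → Route p v (vs ∷ʳ v)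
  route-∷ʳ stop           q~v = step q~v stop
  route-∷ʳ (step p~r rte) q~v = step p~r (route-∷ʳ rte q~v)

  route-linked : ∀ {p q vs} → Route p q vs → Linked _~_ vs
  route-linked stop                      = [-]
  route-linked (step p~q stop)           = p~q ∷ [-]
  route-linked (step p~r rte@(step _ _)) = p~r ∷ route-linked rte

  -- If one end is the newest vertex, the route uses its attaching edge and continues among the
  -- older vertices. It stays simple because the newest vertex is not among them.
  grown-route : ∀ {vs p q} → Grown vs → p ∈ vs → q ∈ vs →
    ∃ λ ys → Route p q ys × Unique ys × (∀ {x} → x ∈ ys → x ∈ vs)
  grown-route {vs} _ (here refl) (here refl) = _ , stop , [] ∷ [] , λ { (here refl) → here refl }
  grown-route (attach {v} v∉ r∈ v~r gr) (here refl) (there q∈)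
    with ys , rte , ys! , ys⊆ ← grown-route gr r∈ q∈ =
    v ∷ ys , step v~r rte , ∉⇒All≢ (v∉ ∘ ys⊆) ∷ ys! , λ { (here refl) → here refl ; (there x∈) → there (ys⊆ x∈) }
  grown-route (attach {v} v∉ r∈ v~r gr) (there p∈) (here refl)
    with ys , rte , ys! , ys⊆ ← grown-route gr p∈ r∈ =
    ys ∷ʳ v , route-∷ʳ rte (~-sym v~r) , unique-∷ʳ ys! (v∉ ∘ ys⊆) ,
    λ x∈ → case ∈-resp-↭ (↭-sym (∷↭∷ʳ v ys)) x∈ of λ { (here refl) → here refl ; (there x∈) → there (ys⊆ x∈) }
  grown-route (attach v∉ r∈ v~r gr) (there p∈) (there q∈)
    with ys , rte , ys! , ys⊆ ← grown-route gr p∈ q∈ = ys , rte , ys! , there ∘ ys⊆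

  -- A simple route between the two neighbours inside `vs` is closed up through `v`, which lies
  -- outside.
  close-cycle : ∀ {vs v p q} → Grown vs → v ∉ vs → p ∈ vs → q ∈ vs → p ≢ q → v ~ p → v ~ q → Cycle G
  close-cycle {v = v} gr v∉ p∈ q∈ p≢q v~p v~q with ys , rte , ys! , ys⊆ ← grown-route gr p∈ q∈ = record
    { x        = v
    ; vs       = ys
    ; long     = long rte
    ; distinct = ∉⇒All≢ (v∉ ∘ ys⊆) ∷ ys!
    ; closed   = route-linked (step v~p (route-∷ʳ rte (~-sym v~q)))
    }
    where
    long : ∀ {ys} → Route _ _ ys → 2 ≤ length ys
    long stop                = contradiction refl p≢q
    long (step _ stop)       = s≤s (s≤s z≤n)
    long (step _ (step _ _)) = s≤s (s≤s z≤n)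

  only-neighbour : Acyclic G → ∀ {vs v p q} → Grown vs → v ∉ vs → p ∈ vs → q ∈ vs → v ~ p → v ~ q → p ≡ q
  only-neighbour acyclic {p = p} {q} gr v∉ p∈ q∈ v~p v~q with p Fin.≟ q
  ... | yes p≡q = p≡q
  ... | no  p≢q = contradiction (close-cycle gr v∉ p∈ q∈ p≢q v~p v~q) acyclic

  degreeIn : List (Fin n) → Fin n → ℕ
  degreeIn vs x = length (filter (x ~?_) vs)

  -- Attaching `v` adds exactly one edge, by `only-neighbour`. It counts once in the degree of `v`
  -- and once in that of `p`, so both sides grow by 2.
  grown-degree-sum : Acyclic G → ∀ {vs} → Grown vs → 2 + sum (map (degreeIn vs) vs) ≡ 2 * length vs
  grown-degree-sum acyclic (root {r}) =
    cong (λ k → 2 + (k + 0)) (cong length (filter-reject (r ~?_) ~-irrefl))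
  grown-degree-sum acyclic (attach {v} {p} {vs} v∉ p∈ v~p gr) = begin
    2 + (degreeIn (v ∷ vs) v + sum (map (degreeIn (v ∷ vs)) vs))
      ≡⟨ cong₂ (λ a b → 2 + (a + b)) (cong length (filter-reject (v ~?_) ~-irrefl)) (sum-filter-∷ _~?_ v vs vs) ⟩
    2 + (degreeIn vs v + (length (filter (_~? v) vs) + sum (map (degreeIn vs) vs)))
      ≡⟨ cong₂ (λ a b → 2 + (a + (b + sum (map (degreeIn vs) vs))))
           (filter-unique-length (v ~?_) vs! p∈ v~p (λ q∈ v~q → only-neighbour acyclic gr v∉ p∈ q∈ v~p v~q))
           (filter-unique-length (_~? v) vs! p∈ (~-sym v~p) (λ q∈ q~v → only-neighbour acyclic gr v∉ p∈ q∈ v~p (~-sym q~v))) ⟩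
    2 + (2 + sum (map (degreeIn vs) vs))
      ≡⟨ cong (2 +_) (grown-degree-sum acyclic gr) ⟩
    2 + 2 * length vs
      ≡⟨ double-suc (length vs) ⟩
    2 * suc (length vs) ∎
    where
    open ≡-Reasoning
    vs! = grown-unique gr
    double-suc : ∀ k → 2 + 2 * k ≡ 2 * suc k
    double-suc = solve-∀

  -- Some edge of a walk from inside `vs` to outside must leave `vs`.
  frontier : ∀ {vs y x} → Star _~_ y x → y ∈ vs → x ∉ vs → ∃₂ λ p v → p ∈ vs × v ∉ vs × p ~ v
  frontier ε y∈ x∉ = contradiction y∈ x∉
  frontier {vs} {y} (_◅_ {j = z} y~z path) y∈ x∉ with z ∈? vs
  ... | yes z∈ = frontier path z∈ x∉
  ... | no  z∉ = y , z , y∈ , z∉ , y~z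

  grown-frontier : Connected G → ∀ {vs x} → Grown vs → x ∉ vs → ∃₂ λ p v → p ∈ vs × v ∉ vs × p ~ v
  grown-frontier connected {x = x} (root {r})         = frontier (connected r x) (here refl)
  grown-frontier connected {x = x} (attach {v} _ _ _ _) = frontier (connected v x) (here refl)

  tree-degree-sum : IsTree G → Fin n → 2 + sum (map deg (allFin n)) ≡ 2 * n
  tree-degree-sum (connected , acyclic) r
    with vs , gr , all∈ ← exhaust Grown grown-unique
           (λ gr x∉ → case grown-frontier connected gr x∉ of λ (p , v , p∈ , v∉ , p~v) → v , attach v∉ p∈ (~-sym p~v) gr)
           (root {r}) = begin
    2 + sum (map deg (allFin n))       ≡⟨ cong (2 +_) (sum-↭ (map⁺ deg vs↭)) ⟨
    -- As `vs` is a permutation of all vertices, neighbours counted within `vs` are all neighbours.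
    2 + sum (map deg vs)               ≡⟨ cong (λ ds → 2 + sum ds) (map-cong (λ x → ↭-length (filter-↭ (x ~?_) (↭-sym vs↭))) vs) ⟩
    2 + sum (map (degreeIn vs) vs)     ≡⟨ grown-degree-sum acyclic gr ⟩
    2 * length vs                      ≡⟨ cong (2 *_) (trans (↭-length vs↭) (length-tabulate {n = n} id)) ⟩
    2 * n                              ∎
    where
    open ≡-Reasoning
    vs↭ = enumeration-↭ (grown-unique gr) all∈

  -- Degree bounds, and trees of maximum degree 2.

  neighbours-length≤deg : ∀ {w ys} → Unique ys → All (w ~_) ys → length ys ≤ deg w
  neighbours-length≤deg {w} ys! w~ys = unique-⊆⇒length≤ ys! λ y∈ → ∈-filter⁺ (w ~?_) (∈-allFin _) (All.lookup w~ys y∈)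

  connected⇒deg≥1 : Connected G → 2 ≤ n → ∀ w → 1 ≤ deg w
  connected⇒deg≥1 connected 2≤n w with u , w≢u ← another 2≤n w | connected w u
  ... | ε       = contradiction refl w≢u
  ... | w~y ◅ _ = neighbours-length≤deg ([] ∷ []) (w~y ∷ [])

  -- A grown list in which every vertex attaches to its predecessor. Starting at a vertex of degree
  -- at most 1 leaves the newest vertex as the only possible place of growth.
  data Line : List (Fin n) → Set where
    start  : ∀ {r} → deg r ≤ 1 → Line (r ∷ [])
    extend : ∀ {v h t} → v ∉ h ∷ t → v ~ h → Line (h ∷ t) → Line (v ∷ h ∷ t)

  line-grown : ∀ {vs} → Line vs → Grown vs
  line-grown (start _)           = root
  line-grown (extend v∉ v~h lin) = attach v∉ (here refl) v~h (line-grown lin)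

  module _ (deg≤2 : ∀ w → deg w ≤ 2) where

    line-interior-closed : ∀ {h t v q} → Line (h ∷ t) → v ∉ h ∷ t → q ∈ t → ¬ (q ~ v)
    -- The starting vertex would have the two neighbours `w` and `v`.
    line-interior-closed (extend {w} w∉ w~h (start deg≤1)) v∉ (here refl) q~v =
      <-irrefl refl (≤-trans (neighbours-length≤deg
        (((λ w≡v → v∉ (here (sym w≡v))) ∷ []) ∷ [] ∷ []) (~-sym w~h ∷ q~v ∷ [])) deg≤1)
    -- An inner vertex already has a neighbour on each side in the line; `v` would be a third.
    line-interior-closed (extend w∉ w~h (extend h∉ h~h′ lin)) v∉ (here refl) q~v =
      <-irrefl refl (≤-trans (neighbours-length≤deg
        (((λ { refl → w∉ (there (here refl)) }) ∷ (λ { refl → v∉ (here refl) }) ∷ []) ∷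
         ((λ { refl → v∉ (there (there (here refl))) }) ∷ []) ∷ [] ∷ [])
        (~-sym w~h ∷ h~h′ ∷ q~v ∷ [])) (deg≤2 _))
    line-interior-closed (extend _ _ lin) v∉ (there q∈) = line-interior-closed lin (v∉ ∘ there) q∈

    line-enlarge : Connected G → ∀ {vs x} → Line vs → x ∉ vs → ∃ λ v → Line (v ∷ vs)
    line-enlarge connected {h ∷ t} lin x∉ with grown-frontier connected (line-grown lin) x∉
    ... | p , v , here refl , v∉ , p~v = v , extend v∉ (~-sym p~v) lin
    ... | p , v , there p∈  , v∉ , p~v = contradiction p~v (line-interior-closed lin v∉ p∈)

  -- By acyclicity, each vertex has among the older ones only the neighbour to which it was
  -- attached, and that one is next in the list.
  line-adjacency : Acyclic G → ∀ {vs} → Line vs → ∀ i j → (lookup vs i ~ lookup vs j) ⇔ (∣ toℕ i - toℕ j ∣ ≡ 1)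
  line-adjacency acyclic (start _)           zero    zero    = mk⇔ (⊥-elim ∘ ~-irrefl) λ ()
  line-adjacency acyclic (extend _ _ _)      zero    zero    = mk⇔ (⊥-elim ∘ ~-irrefl) λ ()
  line-adjacency acyclic (extend {v} {h} {t} v∉ v~h lin) i j = adjacency i j
    where
    gr = line-grown lin
    forward : ∀ k → v ~ lookup (h ∷ t) k → suc (toℕ k) ≡ 1
    forward k v~k = cong (suc ∘ toℕ) (sym (unique-lookup-injective (grown-unique gr) {zero} {k}
      (only-neighbour acyclic gr v∉ (here refl) (∈-lookup k) v~h v~k)))
    backward : ∀ k → suc (toℕ k) ≡ 1 → v ~ lookup (h ∷ t) k
    backward zero _ = v~h
    adjacency : ∀ i j → (lookup (v ∷ h ∷ t) i ~ lookup (v ∷ h ∷ t) j) ⇔ (∣ toℕ i - toℕ j ∣ ≡ 1)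
    adjacency zero    zero    = mk⇔ (⊥-elim ∘ ~-irrefl) λ ()
    adjacency zero    (suc j) = mk⇔ (forward j) (backward j)
    adjacency (suc i) zero    = mk⇔ (forward i ∘ ~-sym) (~-sym ∘ backward i)
    adjacency (suc i) (suc j) = line-adjacency acyclic lin i j

  spanning-line⇒path : Acyclic G → ∀ {vs} → Line vs → (∀ x → x ∈ vs) → G ≅ path (length vs)
  spanning-line⇒path acyclic {vs} lin all∈ = record
    { bijection = mk↔ₛ′ position (lookup vs) position-lookup (sym ∘ lookup-position)
    ; adjacency = λ x y → subst₂ (λ x′ y′ → (x′ ~ y′) ⇔ (∣ toℕ (position x) - toℕ (position y) ∣ ≡ 1))
        (sym (lookup-position x)) (sym (lookup-position y)) (line-adjacency acyclic lin (position x) (position y))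
    }
    where
    position : Fin n → Fin (length vs)
    position x = index (all∈ x)
    lookup-position : ∀ x → x ≡ lookup vs (position x)
    lookup-position x = lookup-index (all∈ x)
    position-lookup : ∀ i → position (lookup vs i) ≡ i
    position-lookup i = unique-lookup-injective (grown-unique (line-grown lin)) (sym (lookup-position (lookup vs i)))

  max-degree-2-tree⇒path : IsTree G → (∀ w → deg w ≤ 2) → ∀ r → deg r ≤ 1 → G ≅ path n
  max-degree-2-tree⇒path (connected , acyclic) deg≤2 r deg≤1
    with vs , lin , all∈ ← exhaust Line (grown-unique ∘ line-grown) (line-enlarge deg≤2 connected) (start deg≤1) =
    subst (λ k → G ≅ path k) (trans (↭-length (enumeration-↭ (grown-unique (line-grown lin)) all∈)) (length-tabulate id))
      (spanning-line⇒path acyclic lin all∈)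

-- Clearing denominators in the comparison with 6n - 20.

open import Data.Integer.Base using (+_; _-_)

fromℚᵘ-mono-≤ : ∀ {p q} → p ℚᵘ.≤ q → fromℚᵘ p ≤ℚ fromℚᵘ q
fromℚᵘ-mono-≤ {p} {q} p≤q = ℚ.toℚᵘ-cancel-≤ (begin
  toℚᵘ (fromℚᵘ p) ≃⟨ ℚ.toℚᵘ-fromℚᵘ p ⟩
  p                 ≤⟨ p≤q ⟩
  q                 ≃⟨ ℚ.toℚᵘ-fromℚᵘ q ⟨
  toℚᵘ (fromℚᵘ q) ∎)
  where open ℚᵘ.≤-Reasoning

module _ (n s : ℕ) where
  private
    double-bound : (+ (6 * n) - + 20) ℤ.* + 2 ≡ + (12 * n) - + 40
    double-bound = begin
      (+ (6 * n) - + 20) ℤ.* + 2        ≡⟨ ℤ.*-distribʳ-+ (+ 2) (+ (6 * n)) (ℤ.- + 20) ⟩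
      + (6 * n) ℤ.* + 2 - + 40          ≡⟨ cong (_- + 40) (ℤ.*-comm (+ (6 * n)) (+ 2)) ⟩
      + 2 ℤ.* + (6 * n) - + 40          ≡⟨ cong (_- + 40) (ℤ.pos-* 2 (6 * n)) ⟨
      + (2 * (6 * n)) - + 40            ≡⟨ cong (λ k → + k - + 40) (*-assoc 2 6 n) ⟨
      + (12 * n) - + 40                 ∎
      where open ≡-Reasoning

    add-sub : + s ℤ.* + 1 ≡ + (s + 40) - + 40
    add-sub = begin
      + s ℤ.* + 1              ≡⟨ ℤ.*-identityʳ (+ s) ⟩
      + s                      ≡⟨ ℤ.+-identityʳ (+ s) ⟨
      + s ℤ.+ (+ 40 - + 40)    ≡⟨ ℤ.+-assoc (+ s) (+ 40) (ℤ.- + 40) ⟨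
      + (s + 40) - + 40        ∎
      where open ≡-Reasoning

  -- Cross-multiplication gives 12n - 40 ≤ s; moving 40 across avoids truncated subtraction in ℕ.
  half-≥ : 12 * n ≤ s + 40 → + s / 2 ≥ (+ (6 * n) - + 20) / 1
  -- `mkℚᵘ` stores the denominator minus one: 0 and 1 stand for the denominators 1 and 2.
  half-≥ le = fromℚᵘ-mono-≤ {mkℚᵘ (+ (6 * n) - + 20) 0} {mkℚᵘ (+ s) 1}
    (*≤* (subst₂ ℤ._≤_ (sym double-bound) (sym add-sub) (ℤ.+-monoˡ-≤ (ℤ.- + 40) (ℤ.+≤+ le))))

  half-≡ : + s / 2 ≡ (+ (6 * n) - + 20) / 1 ⇔ 12 * n ≡ s + 40
  half-≡ = mk⇔ to from
    where
    to : + s / 2 ≡ (+ (6 * n) - + 20) / 1 → 12 * n ≡ s + 40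
    to eq with *≡* eqᵘ ← ℚ.fromℚᵘ-injective {mkℚᵘ (+ s) 1} {mkℚᵘ (+ (6 * n) - + 20) 0} eq =
      ℤ.+-injective (ℤ-Group.∙-cancelʳ (ℤ.- + 40) _ _ (trans (sym double-bound) (trans (sym eqᵘ) add-sub)))
    from : 12 * n ≡ s + 40 → + s / 2 ≡ (+ (6 * n) - + 20) / 1
    from eq = ℚ.fromℚᵘ-cong {mkℚᵘ (+ s) 1} {mkℚᵘ (+ (6 * n) - + 20) 0}
      (*≡* (trans add-sub (trans (cong (λ k → + k - + 40) (sym eq)) (sym double-bound))))

-- From degree multisets back to trees.

module _ {n : ℕ} (G : Graph n) where
  open Graph G

  private
    degrees : List ℕ
    degrees = map deg (allFin n)

    length-degrees : length degrees ≡ n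
    length-degrees = trans (length-map deg (allFin n)) (length-tabulate id)

    deg∈degrees : ∀ w → deg w ∈ degrees
    deg∈degrees w = ∈-map⁺ deg (∈-allFin w)

  irrₜ-gap : irrₜ G ≡ + gap degrees degrees / 2
  irrₜ-gap = cong (λ s → + s / 2) (sum-gap deg (allFin n))

  path-like⇒path : IsTree G → ∀ {m} → degrees ↭ profile [] m 2 → G ≅ path n
  path-like⇒path tree {m} σ
    -- The first of the two ones in the profile supplies a leaf at which the line can start.
    with r , _ , 1≡deg ← ∈-map⁻ deg (∈-resp-↭ (↭-sym σ) (∈-++⁺ʳ (replicate m 2) (here refl))) =
    max-degree-2-tree⇒path G tree (λ w → All.lookup degrees≤2 (deg∈degrees w)) r (≤-reflexive (sym 1≡deg))
    where
    degrees≤2 : All (_≤ 2) degrees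
    degrees≤2 = All-resp-↭ (↭-sym σ) (All.++⁺ (All.replicate⁺ m ≤-refl) (s≤s z≤n ∷ s≤s z≤n ∷ []))

  -- A profile with nonincreasing `cs` is already sorted, and the total length `n` determines `m`.
  profile⇒degreeSequence : ∀ cs m l → AllPairs _≥ℕ_ cs → degrees ↭ profile cs m l →
    degreeSequence G ≡ profile cs (n ∸ (length cs + l)) l
  profile⇒degreeSequence cs m l cs↘ σ =
    trans (sort-unique (profile-≥ m l cs↘) σ) (cong (λ k → profile cs k l) (sym n∸≡m))
    where
    open ≡-Reasoning
    swap : ∀ a b c → a + (b + c) ≡ b + (a + c)
    swap = solve-∀
    n∸≡m : n ∸ (length cs + l) ≡ m
    n∸≡m = begin
      n ∸ (length cs + l)                          ≡⟨ cong (_∸ (length cs + l)) (trans (sym length-degrees) (length-via-profile cs m l σ)) ⟩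
      length cs + (m + l) ∸ (length cs + l)        ≡⟨ cong (_∸ (length cs + l)) (swap (length cs) m l) ⟩
      m + (length cs + l) ∸ (length cs + l)        ≡⟨ m+n∸n≡m m (length cs + l) ⟩
      m                                            ∎

  two-threes⇒gap : degreeSequence G ≡ profile (0 ∷ 0 ∷ []) (n ∸ 6) 4 → 12 * n ≡ gap degrees degrees + 40
  two-threes⇒gap eq = subst (λ k → 12 * k ≡ gap degrees degrees + 40) length-degrees
    (two-threes-gap (n ∸ 6) (↭-trans (↭-sym (sort-↭ ≥-decTotalOrder degrees)) (↭-reflexive eq)))

  tree-gap-bound : 2 ≤ n → IsTree G → ¬ (G ≅ path n) → degreeSequence G ≢ profile (0 ∷ []) (n ∸ 4) 3 →
    12 * n ≤ gap degrees degrees + 40 ×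
    (12 * n ≡ gap degrees degrees + 40 → degreeSequence G ≡ profile (0 ∷ 0 ∷ []) (n ∸ 6) 4)
  tree-gap-bound 2≤n tree@(connected , _) ¬path ¬one-three with tree-gap-cases 1≤degrees handshake
    where
    1≤degrees : All (1 ≤_) degrees
    1≤degrees = All.map⁺ (All.universal (connected⇒deg≥1 G connected 2≤n) (allFin n))
    some-vertex : ∀ {n} → 2 ≤ n → Fin n
    some-vertex (s≤s _) = zero
    handshake : 2 + sum degrees ≡ 2 * length degrees
    handshake = trans (tree-degree-sum G tree (some-vertex 2≤n)) (cong (2 *_) (sym length-degrees))
  ... | m , path-like σ  = contradiction (path-like⇒path tree {m} σ) ¬path
  ... | m , one-three σ  = contradiction (profile⇒degreeSequence (0 ∷ []) m 3 ([] ∷ []) σ) ¬one-three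
  ... | m , two-threes σ = ≤-reflexive (two-threes⇒gap sequence) , λ _ → sequence
    where
    sequence : degreeSequence G ≡ profile (0 ∷ 0 ∷ []) (n ∸ 6) 4
    sequence = profile⇒degreeSequence (0 ∷ 0 ∷ []) m 4 ((z≤n ∷ []) ∷ [] ∷ []) σ
  -- Strictness gives the bound and rules out equality.
  ... | m , large gap>   = <⇒≤ gap>′ , λ eq → contradiction gap>′ (<-irrefl eq)
    where
    gap>′ : 12 * n < gap degrees degrees + 40
    gap>′ = subst (λ k → 12 * k < gap degrees degrees + 40) length-degrees gap>

theorem7 : (n : ℕ) → n ≥ℕ 6 →
    (G : Graph n) → IsTree G →
    ¬ (G ≅ path n) →
    degreeSequence G ≢ 3 ∷ replicate (n ∸ 4) 2 ++ replicate 3 1 →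
    (irrₜ G ≥ (+ (6 * n) - + 20) / 1) ×
    (irrₜ G ≡ (+ (6 * n) - + 20) / 1 ⇔
    degreeSequence G ≡ 3 ∷ 3 ∷ replicate (n ∸ 6) 2 ++ replicate 4 1)
theorem7 n n≥6 G tree ¬path ¬one-three
  -- The profiles in `tree-gap-bound` compute to the explicit lists of the statement, so no
  -- conversion is required.
  with bound , equality ← tree-gap-bound G (≤-trans (s≤s (s≤s z≤n)) n≥6) tree ¬path ¬one-three =
  subst (_≥ (+ (6 * n) - + 20) / 1) (sym (irrₜ-gap G)) (half-≥ n s bound) ,
  mk⇔ (λ eq → equality (Equivalence.to (half-≡ n s) (trans (sym (irrₜ-gap G)) eq)))
      (λ eq → trans (irrₜ-gap G) (Equivalence.from (half-≡ n s) (two-threes⇒gap G eq)))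
  where
  s : ℕ
  s = gap (map (Graph.deg G) (allFin n)) (map (Graph.deg G) (allFin n))
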